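{- Let $PO$ be a program order and $M$ a program block map, and let $E=(w_0,\dots,w_n)$ be a valid final memory execution sequence of the operational TSO model for $(PO,M)$. Let $x$ be the executed sequence (the first component) of the last witness $w_n$. Then $x$ satisfies the TSO axioms with respect to $(PO,M)$, that is: (i) for all identifiers $id,id'$, Axiom Order holds for $(id,id',x,M)$; (ii) for all identifiers $id$, Axiom Termination holds for $(id,PO,x,M)$; (iii) for all identifiers $id,id'$, Axiom LoadOp holds for $(id,id',PO,x,M)$; (iv) for all identifiers $id,id'$, Axiom StoreStore holds for $(id,id',PO,x,M)$; (v) for all identifiers $id,id'$, Axiom Atomicity holds for $(id,id',PO,x,M)$ (with $id$ in the role of $id_l$ and $id'$ in the role of $id_s$).
   Context: **Programs.** Processors and identifiers are natural numbers. A program block map $M$ assigns to each identifier $id$ a block: a list of instructions (containing at most one memory access instruction, which is then last), a processor $proc(id)$, and an optional identifier $atom(id)$ (possibly undefined; for an atomic store block it is the identifier of the atomic load block coming from the same atomic load-store instruction). Each block has a type $type_{id}\in\{ld,st,ald,ast,non\}$ (load, store, atomic load, atomic store, no memory operation). "Store operation" below means type in $\{st,ast\}$. A program order $PO$ assigns to each processor $p$ a finite list $PO(p)$ of identifiers. Write $id_1;_p id_2$ if $id_1$ occurs before $id_2$ in the list $PO(p)$, and $id_1;id_2$ if $id_1;_p id_2$ for some $p$. **Valid program.** $(PO,M)$ is a valid program if: (1) for all $a,b,c$: if $atom(a)$ is defined and equals $b$, and $a\ne c$, then $atom(c)$ is not equal to $b$; (2) if $a\in PO(p)$ has type $ald$,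 there is $b$ with $a;_p b$, $type_b=ast$, $atom(b)=a$; (3) if $b\in PO(p)$ has type $ast$, there is $a$ with $a;_p b$, $type_a=ald$, $atom(b)=a$; (4) every list $PO(p)$ has no repeated elements; (5) if $a;_p b$ then $proc(a)=proc(b)=p$; (6) if $a\in PO(p)$ then $proc(a)=p$. **Memory order.** For a finite sequence $x$ of identifiers, $id_1<_x id_2$ is the partial truth value: if both are in $x$, it is true iff $id_1$ is before $id_2$ in $x$ (and false otherwise); if only $id_1$ is in $x$, true; if only $id_2$ is in $x$, false; if neither is in $x$, undefined. Asserting $id_1<_x id_2$ means that this value is (defined and) true. **Axioms.** - Order$(id,id',x,M)$: if $id,id'$ are both store operations, both in $x$, and $id\neq id'$, then $id<_x id'$ or $id'<_x id$. - Termination$(id,PO,x,M)$: if $id\in PO(p)$ for some $p$ and $id$ is a store operation, then $id\in x$. - LoadOp$(id,id',PO,x,M)$: if $type_{id}\in\{ld,ald\}$ and $id;id'$, then $id<_x id'$. - StoreStore$(id,id',PO,x,M)$: if $id,id'$ are store operations and $id;id'$, then $id<_x id'$. - Atomicity$(id_l,id_s,PO,x,M)$: if $atom(id_s)=id_l$ (they come from the same instruction instance), $id_l;id_s$, $type_{id_l}=ald$ and $type_{id_s}=ast$, then $id_l<_x id_s$, and for every store operation $id\in x$ with $id\ne id_s$, either $id<_x id_l$ or $id_s<_x id$. **States.** There is a nonempty set of machine states (control and general registers, memory, annul flags, recorded address $op_{addr}$ and value $op_{val}$ of each operation, next-block indices, and a global flag). Each state $s$ has a component $flag_{atom}(s)$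 which is either an identifier or undefined. The instruction semantics supplies total functions on states (depending on $PO,M$): $exe_{id}$ (processor $proc(id)$ executes its blocks in program order from its next-block index through $id$), $exe^{pre}_{id}$ (the same, but stopping before the last instruction of block $id$), $exe^{last}_{id}\,v$ (executes the last instruction of block $id$, a load, with loaded 32-bit word $v$), and $W_{mem}\,id$ (writes $op_{val}$ of $id$ at address $op_{addr}$ of $id$ in memory). None of these changes $flag_{atom}$. These functions may be regarded as given parameters. $flag^{set}_{atom}\,v\,s$ is the state $s$ with $flag_{atom}$ set to $v$ ($v$ an identifier or $undef$). $Lval_{id}$ is the word determined by Axiom Value from the current $x$ and state: $op_{val}$ of the last element, in the order $<$ (memory order before), of the set of store operations $id'$ whose $op_{addr}$ equals the load address of $id$ and which satisfy $id'<_x id$ or $id';id$ (an arbitrary fixed word if this does not determine an element). **Operational model.** A step executing $id$, written $x,s\leadsto_{id}x',s'$, holds iff $x'=x@[id]$ ($@$ is concatenation) and one of the following holds: - (load) $type_{id}=ld$; every $id'$ with $id';id$ and $type_{id'}\in\{ld,ald\}$ is in $x$; $s'=exe^{last}_{id}\,Lval_{id}\,(exe^{pre}_{id}\,s)$. - (store) $type_{id}=st$; $flag_{atom}(s)$ undefined; every $id'$ with $id';id$ and $type_{id'}\in\{ld,ald,st,ast\}$ is in $x$; $s'=W_{mem}\,id\,(exe_{id}\,s)$. - (atom_load) $type_{id}=ald$; $flag_{atom}(s)$ undefined; every $id'$ with $id';id$ and $type_{id'}\in\{ld,ald,st,ast\}$ is in $x$; $s'=flag^{set}_{atom}\,id\,(exe^{last}_{id}\,Lval_{id}\,(exe^{pre}_{id}\,s))$.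 - (atom_store) $type_{id}=ast$; $flag_{atom}(s)$ and $atom(id)$ are both defined and equal; every $id''$ with $id'';id$ and $type_{id''}\in\{ld,ald,st,ast\}$ is in $x$; $s'=W_{mem}\,id\,(flag^{set}_{atom}\,undef\,(exe_{id}\,s))$. - (non_mem) $type_{id}=non$; every $id'$ with $id';id$ and $type_{id'}\in\{ld,ald,st,ast\}$ is in $x$; $s'=exe_{id}\,s$. **Execution sequences.** A witness is a triple $(x,R,s)$: executed sequence $x$, set $R$ of remaining identifiers, state $s$. There is a transition $(x,R,s)\to(x',R',s')$ iff there is $id\in R$ with $x,s\leadsto_{id}x',s'$ and $R'=R\setminus\{id\}$. A valid memory execution sequence for $(PO,M)$ is a nonempty finite list of witnesses $w_0,\dots,w_n$ such that: $(PO,M)$ is a valid program; the executed sequence of $w_0$ is empty; the remaining set of $w_0$ is exactly $\{id : id\in PO(p)\text{ for some }p\}$; $flag_{atom}$ of the state of $w_0$ is undefined; and $w_i\to w_{i+1}$ for all $i<n$. It is final if moreover the remaining set of $w_0$ equals the set of elements of the executed sequence of $w_n$. -}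

module Defs where

open import Data.Bool.Base using (Bool; true; false; T)
open import Data.Fin.Base using (Fin; zero; suc; inject₁) renaming (_<_ to _<ᶠ_)
open import Data.Fin.Properties using (any?) renaming (_<?_ to _<ᶠ?_)
open import Data.List.Base using (List; []; _∷_; _++_; _∷ʳ_; length; lookup)
open import Data.List.Membership.Propositional using (_∈_)
open import Data.List.Relation.Unary.Any using (Any)
open import Data.List.Relation.Unary.Unique.Propositional using (Unique)
open import Data.Maybe.Base using (Maybe; just; nothing)
open import Data.Nat.Base using (ℕ) renaming (suc to 1+_)
open import Data.Nat.Properties using (_≟_)
open import Data.List.Membership.DecPropositional _≟_ using (_∈?_)
open import Data.Product.Base using (_×_; ∃-syntax)
open import Data.Sum.Base using (_⊎_)
open import Data.Vec.Base using (Vec)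
open import Data.Vec.Functional using (Vector; last)
open import Function.Bundles using (_⇔_)
open import Level using (0ℓ)
open import Relation.Binary.PropositionalEquality using (_≡_; _≢_)
open import Relation.Nullary.Decidable using (Dec; yes; no; does; _×-dec_)
open import Relation.Nullary.Negation using (¬_)
open import Relation.Unary using (Pred; _≐_; _∖_; ｛_｝)

Id Proc : Set
Id   = ℕ
Proc = ℕ

Word32 : Set
Word32 = Vec Bool 32

data OpType : Set where
  ld st ald ast non : OpType

record ISA : Set₁ where
  field
    Instr       : Set
    isMemAccess : Instr → Bool

record Block (I : ISA) : Set where
  open ISA I
  field
    insts   : List Instr
    proc    : Proc
    atom    : Maybe Id
    type    : OpType
    memLast : ∀ is i js → insts ≡ is ++ i ∷ js → T (isMemAccess i) → js ≡ []
    typeNon : type ≡ non ⇔ (¬ Any (λ i → T (isMemAccess i)) insts)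

BlockMap : ISA → Set
BlockMap I = Id → Block I

ProgramOrder : Set
ProgramOrder = Proc → List Id

module _ {I : ISA} (M : BlockMap I) where

  procOf : Id → Proc
  procOf id = Block.proc (M id)

  atomOf : Id → Maybe Id
  atomOf id = Block.atom (M id)

  typeOf : Id → OpType
  typeOf id = Block.type (M id)

  IsLoad IsStore IsMemOp : Pred Id 0ℓ
  IsLoad  id = typeOf id ≡ ld ⊎ typeOf id ≡ ald
  IsStore id = typeOf id ≡ st ⊎ typeOf id ≡ ast
  IsMemOp id = IsLoad id ⊎ IsStore id

Before : List Id → Id → Id → Set
Before xs a b =
  ∃[ i ] ∃[ j ] (i <ᶠ j × lookup xs i ≡ a × lookup xs j ≡ b)

before? : ∀ xs a b → Dec (Before xs a b)
before? xs a b = any? λ i → any? λ j →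
  (i <ᶠ? j) ×-dec (lookup xs i ≟ a) ×-dec (lookup xs j ≟ b)

_⊢_︔[_]_ : ProgramOrder → Id → Proc → Id → Set
PO ⊢ a ︔[ p ] b = Before (PO p) a b

_⊢_︔_ : ProgramOrder → Id → Id → Set
PO ⊢ a ︔ b = ∃[ p ] PO ⊢ a ︔[ p ] b

InProgram : ProgramOrder → Pred Id 0ℓ
InProgram PO id = ∃[ p ] id ∈ PO p

record ValidProgram {I : ISA} (PO : ProgramOrder) (M : BlockMap I) : Set where
  field
    atomInjective : ∀ a b c → atomOf M a ≡ just b → a ≢ c → atomOf M c ≢ just b
    aldPaired     : ∀ p a → a ∈ PO p → typeOf M a ≡ ald →
                    ∃[ b ] (PO ⊢ a ︔[ p ] b × typeOf M b ≡ ast × atomOf M b ≡ just a)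
    astPaired     : ∀ p b → b ∈ PO p → typeOf M b ≡ ast →
                    ∃[ a ] (PO ⊢ a ︔[ p ] b × typeOf M a ≡ ald × atomOf M b ≡ just a)
    unique        : ∀ p → Unique (PO p)
    orderProc     : ∀ p a b → PO ⊢ a ︔[ p ] b → procOf M a ≡ p × procOf M b ≡ p
    memberProc    : ∀ p a → a ∈ PO p → procOf M a ≡ p

memOrder : List Id → Id → Id → Maybe Bool
memOrder x a b with a ∈? x | b ∈? x
... | yes _ | yes _ = just (does (before? x a b))
... | yes _ | no  _ = just true
... | no  _ | yes _ = just false
... | no  _ | no  _ = nothing

_<[_]_ : Id → List Id → Id → Set
a <[ x ] b = memOrder x a b ≡ just true

module _ {I : ISA} where

  Order : Id → Id → List Id → BlockMap I → Set
  Order id id′ x M =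
    IsStore M id → IsStore M id′ → id ∈ x → id′ ∈ x → id ≢ id′ →
    id <[ x ] id′ ⊎ id′ <[ x ] id

  Termination : Id → ProgramOrder → List Id → BlockMap I → Set
  Termination id PO x M = InProgram PO id → IsStore M id → id ∈ x

  LoadOp : Id → Id → ProgramOrder → List Id → BlockMap I → Set
  LoadOp id id′ PO x M = IsLoad M id → PO ⊢ id ︔ id′ → id <[ x ] id′

  StoreStore : Id → Id → ProgramOrder → List Id → BlockMap I → Set
  StoreStore id id′ PO x M =
    IsStore M id → IsStore M id′ → PO ⊢ id ︔ id′ → id <[ x ] id′

  Atomicity : Id → Id → ProgramOrder → List Id → BlockMap I → Set
  Atomicity idₗ idₛ PO x M =
    atomOf M idₛ ≡ just idₗ → PO ⊢ idₗ ︔ idₛ →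
    typeOf M idₗ ≡ ald → typeOf M idₛ ≡ ast →
    idₗ <[ x ] idₛ ×
    (∀ id → IsStore M id → id ∈ x → id ≢ idₛ → id <[ x ] idₗ ⊎ idₛ <[ x ] id)

-- Core holds every component of the state other than the atomic flag.
record State (Core : Set) : Set where
  constructor ⟨_,_⟩
  field
    core     : Core
    flagAtom : Maybe Id

open State public

setFlag : ∀ {Core} → Maybe Id → State Core → State Core
setFlag v s = record s { flagAtom = v }

record Semantics {I : ISA} (PO : ProgramOrder) (M : BlockMap I) : Set₁ where
  field
    Core      : Set
    someCore  : Core
    Address   : Set
    opAddr    : Core → Id → Address
    opVal     : Core → Id → Word32
    loadAddr  : Core → Id → Address
    someWord  : Word32

    exe       : Id → State Core → State Core
    exePre    : Id → State Core → State Core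
    exeLast   : Id → Word32 → State Core → State Core
    writeMem  : Id → State Core → State Core

    exe-flag      : ∀ id s → flagAtom (exe id s) ≡ flagAtom s
    exePre-flag   : ∀ id s → flagAtom (exePre id s) ≡ flagAtom s
    exeLast-flag  : ∀ id v s → flagAtom (exeLast id v s) ≡ flagAtom s
    writeMem-flag : ∀ id s → flagAtom (writeMem id s) ≡ flagAtom s

module _ {I : ISA} {PO : ProgramOrder} {M : BlockMap I} (Sem : Semantics PO M) where
  open Semantics Sem

  VisibleStore : Id → List Id → State Core → Pred Id 0ℓ
  VisibleStore id x s id′ =
    IsStore M id′ × opAddr (core s) id′ ≡ loadAddr (core s) id ×
    (id′ <[ x ] id ⊎ PO ⊢ id′ ︔ id)

  LastVisibleStore : Id → List Id → State Core → Pred Id 0ℓ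
  LastVisibleStore id x s m =
    VisibleStore id x s m ×
    (∀ id′ → VisibleStore id x s id′ → id′ ≢ m → id′ <[ x ] m)

  -- A relation rather than a function: the visible stores range over all processors' program
  -- orders, so whether a last one exists is not decidable for arbitrary PO.
  Lval : Id → List Id → State Core → Pred Word32 0ℓ
  Lval id x s v =
    (∃[ m ] (LastVisibleStore id x s m × v ≡ opVal (core s) m)) ⊎
    ((¬ (∃[ m ] LastVisibleStore id x s m)) × v ≡ someWord)

  Executed : Pred Id 0ℓ → Id → List Id → Set
  Executed P id x = ∀ id′ → PO ⊢ id′ ︔ id → P id′ → id′ ∈ x

  -- The load value is read off in the state exePre id s, where the load address
  -- of id and the addresses and values of earlier stores have been computed.
  data Rule (x : List Id) (s : State Core) (id : Id) (s′ : State Core) : Set where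
    load : ∀ v →
      typeOf M id ≡ ld →
      Executed (IsLoad M) id x →
      Lval id x (exePre id s) v →
      s′ ≡ exeLast id v (exePre id s) →
      Rule x s id s′
    store :
      typeOf M id ≡ st →
      flagAtom s ≡ nothing →
      Executed (IsMemOp M) id x →
      s′ ≡ writeMem id (exe id s) →
      Rule x s id s′
    atomLoad : ∀ v →
      typeOf M id ≡ ald →
      flagAtom s ≡ nothing →
      Executed (IsMemOp M) id x →
      Lval id x (exePre id s) v →
      s′ ≡ setFlag (just id) (exeLast id v (exePre id s)) →
      Rule x s id s′
    atomStore : ∀ a →
      typeOf M id ≡ ast →
      flagAtom s ≡ just a →
      atomOf M id ≡ just a →
      Executed (IsMemOp M) id x →
      s′ ≡ writeMem id (setFlag nothing (exe id s)) →
      Rule x s id s′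
    nonMem :
      typeOf M id ≡ non →
      Executed (IsMemOp M) id x →
      s′ ≡ exe id s →
      Rule x s id s′

  Step : Id → List Id → State Core → List Id → State Core → Set
  Step id x s x′ s′ = x′ ≡ x ∷ʳ id × Rule x s id s′

  record Witness : Set₁ where
    constructor witness
    field
      executed  : List Id
      remaining : Pred Id 0ℓ
      state     : State Core

  open Witness public

  _⟶_ : Witness → Witness → Set
  w ⟶ w′ = ∃[ id ] (remaining w id ×
                    Step id (executed w) (state w) (executed w′) (state w′) ×
                    remaining w′ ≐ remaining w ∖ ｛ id ｝)

  record ValidExecution {n : ℕ} (E : Vector Witness (1+ n)) : Set where
    field
      validProgram   : ValidProgram PO M
      startExecuted  : executed (E zero) ≡ []
      startRemaining : remaining (E zero) ≐ InProgram PO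
      startFlag      : flagAtom (state (E zero)) ≡ nothing
      steps          : ∀ (i : Fin n) → E (inject₁ i) ⟶ E (suc i)

  record ValidFinalExecution {n : ℕ} (E : Vector Witness (1+ n)) : Set where
    field
      validExecution : ValidExecution E
      final          : remaining (E zero) ≐ (_∈ executed (last E))

{-# OPTIONS --safe #-}
-- A rule fires only once the loads (for a store, all memory operations) preceding
-- its block in program order have been executed, which gives LoadOp and StoreStore.
-- For Atomicity, executing the atomic load l sets the atomic flag to l.  While the
-- flag is l, the only store that can run is an atomic store coming from l, and the
-- program has only one; so every other store executed after l comes after that one.
module Submission where

open import Data.Fin.Base using (zero; suc)
open import Data.Fin.Induction using (<-weakInduction)
open import Data.List.Base using (List; []; _∷_; _++_; _∷ʳ_)
open import Data.List.Membership.Propositional using (_∈_)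
open import Data.List.Membership.Propositional.Properties
  using (∈-lookup; ∈-++⁺ˡ; ∈-++⁺ʳ; ∈-++⁻)
open import Data.List.Relation.Unary.Any using (here; there; index)
open import Data.List.Relation.Unary.Any.Properties using (lookup-index)
open import Data.Maybe.Base using (just; nothing)
open import Data.Nat.Base using (ℕ; suc; s≤s; z<s; s<s)
open import Data.Nat.Properties using (_≟_)
open import Data.List.Membership.DecPropositional _≟_ using (_∈?_)
open import Data.Product.Base using (_×_; _,_; proj₁; proj₂; map₂)
open import Data.Sum.Base as Sum using (_⊎_; inj₁; inj₂)
open import Data.Vec.Functional using (Vector; last)
open import Function.Base using (case_of_)
open import Relation.Binary.PropositionalEquality
  using (_≡_; _≢_; refl; sym; trans; cong; subst)
open import Relation.Nullary.Decidable using (yes; no; dec-true; decidable-stable)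
open import Relation.Nullary.Negation using (contradiction)
open import Defs

private variable
  a b c : Id
  xs ys : List Id

before-here : b ∈ xs → Before (a ∷ xs) a b
before-here b∈xs = zero , suc (index b∈xs) , z<s , refl , sym (lookup-index b∈xs)

before-there : Before xs a b → Before (c ∷ xs) a b
before-there (i , j , i<j , p , q) = suc i , suc j , s<s i<j , p , q

before⇒∈ˡ : Before xs a b → a ∈ xs
before⇒∈ˡ {xs} (i , _ , _ , refl , _) = ∈-lookup {xs = xs} i

before⇒∈ʳ : Before xs a b → b ∈ xs
before⇒∈ʳ {xs} (_ , j , _ , _ , refl) = ∈-lookup {xs = xs} j

before-++⁺ˡ : Before xs a b → Before (xs ++ ys) a b
before-++⁺ˡ {x ∷ xs} (zero , suc j , _ , refl , refl) =
  before-here (∈-++⁺ˡ (∈-lookup {xs = xs} j))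
before-++⁺ˡ {x ∷ xs} (suc i , suc j , s≤s i<j , p , q) =
  before-there (before-++⁺ˡ {xs} (i , j , i<j , p , q))

before-∷ʳ : a ∈ xs → Before (xs ∷ʳ b) a b
before-∷ʳ {xs = _ ∷ xs} (here refl) = before-here (∈-++⁺ʳ xs (here refl))
before-∷ʳ (there a∈xs)              = before-there (before-∷ʳ a∈xs)

before-connex : a ∈ xs → b ∈ xs → a ≢ b → Before xs a b ⊎ Before xs b a
before-connex (here refl)  (here refl)  a≢b = contradiction refl a≢b
before-connex (here refl)  (there b∈xs) _   = inj₁ (before-here b∈xs)
before-connex (there a∈xs) (here refl)  _   = inj₂ (before-here a∈xs)
before-connex (there a∈xs) (there b∈xs) a≢b =
  Sum.map before-there before-there (before-connex a∈xs b∈xs a≢b)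

before⇒< : Before xs a b → a <[ xs ] b
before⇒< {xs} {a} {b} a<b with a ∈? xs | b ∈? xs
... | yes _   | yes _   = cong just (dec-true (before? xs a b) a<b)
-- The value is already true when only the first identifier is present, so this impossible case need
-- not be refuted.
... | yes _   | no _    = refl
... | no a∉xs | _       = contradiction (before⇒∈ˡ a<b) a∉xs

︔⇒InProgramˡ : ∀ {PO} → PO ⊢ a ︔ b → InProgram PO a
︔⇒InProgramˡ = map₂ before⇒∈ˡ

︔⇒InProgramʳ : ∀ {PO} → PO ⊢ a ︔ b → InProgram PO b
︔⇒InProgramʳ = map₂ before⇒∈ʳ

module _ {I : ISA} {PO : ProgramOrder} {M : BlockMap I} (Sem : Semantics PO M) where
  open Semantics Sem

  -- Executions with the remaining sets and indices forgotten. Growing by one identifier at the end,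
  -- like the executed sequence, it permits induction on the last step.
  data Run : List Id → State Core → Set where
    start : ∀ {s} → flagAtom s ≡ nothing → Run [] s
    step  : ∀ {x s id s′} → Run x s → Rule Sem x s id s′ → Run (x ∷ʳ id) s′

  validExecution⇒run : ∀ {n} {E : Vector (Witness Sem) (suc n)} → ValidExecution Sem E →
                       ∀ i → Run (executed (E i)) (state (E i))
  validExecution⇒run {E = E} V = <-weakInduction P run₀ runₛ
    where
    open ValidExecution V
    P = λ i → Run (executed (E i)) (state (E i))

    run₀ : P zero
    run₀ = subst (λ x → Run x (state (E zero))) (sym startExecuted) (start startFlag)

    runₛ : ∀ i → _ → P (suc i)
    runₛ i r with steps i
    ... | _ , _ , (x′≡ , rule) , _ = subst (λ x → Run x _) (sym x′≡) (step r rule)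

  -- Every rule waits at least for the earlier loads; all rules but `load` wait for every earlier
  -- memory operation.
  rule-load : ∀ {x s s′} → Rule Sem x s b s′ → IsLoad M a → PO ⊢ a ︔ b → a ∈ x
  rule-load (load _ _ ex _ _)        la a︔b = ex _ a︔b la
  rule-load (store _ _ ex _)         la a︔b = ex _ a︔b (inj₁ la)
  rule-load (atomLoad _ _ _ ex _ _)  la a︔b = ex _ a︔b (inj₁ la)
  rule-load (atomStore _ _ _ _ ex _) la a︔b = ex _ a︔b (inj₁ la)
  rule-load (nonMem _ ex _)          la a︔b = ex _ a︔b (inj₁ la)

  load≢store : IsLoad M a → IsStore M b → a ≢ b
  load≢store (inj₁ p) (inj₁ q) refl = case trans (sym p) q of λ ()
  load≢store (inj₁ p) (inj₂ q) refl = case trans (sym p) q of λ ()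
  load≢store (inj₂ p) (inj₁ q) refl = case trans (sym p) q of λ ()
  load≢store (inj₂ p) (inj₂ q) refl = case trans (sym p) q of λ ()

  non≢store : typeOf M a ≡ non → IsStore M b → a ≢ b
  non≢store p (inj₁ q) refl = case trans (sym p) q of λ ()
  non≢store p (inj₂ q) refl = case trans (sym p) q of λ ()

  -- The rule `load` lets a load overtake earlier stores, the relaxation typical of TSO. As `b` is a
  -- store, its type leaves only `store` and `atomStore`, which both wait for earlier stores.
  rule-store : ∀ {x s s′} → Rule Sem x s b s′ → IsStore M a → IsStore M b →
               PO ⊢ a ︔ b → a ∈ x
  rule-store (load _ p _ _ _)         sa sb a︔b = contradiction refl (load≢store (inj₁ p) sb)
  rule-store (store _ _ ex _)         sa sb a︔b = ex _ a︔b (inj₂ sa)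
  rule-store (atomLoad _ p _ _ _ _)   sa sb a︔b = contradiction refl (load≢store (inj₂ p) sb)
  rule-store (atomStore _ _ _ _ ex _) sa sb a︔b = ex _ a︔b (inj₂ sa)
  rule-store (nonMem p _ _)           sa sb a︔b = contradiction refl (non≢store p sb)

  -- Turns a precondition of single steps into an order on the whole sequence: at the step that
  -- appends `b`, the prefix already contains `a`, and later steps only extend the sequence.
  run-before : (∀ {x s s′} → Rule Sem x s b s′ → a ∈ x) →
               ∀ {x s} → Run x s → b ∈ x → Before x a b
  run-before prior (step {x = x} r rule) b∈ with ∈-++⁻ x b∈
  ... | inj₁ b∈x         = before-++⁺ˡ {x} (run-before prior r b∈x)
  ... | inj₂ (here refl) = before-∷ʳ (prior rule)

  rule-setsFlag : ∀ {x s s′} → typeOf M a ≡ ald → Rule Sem x s a s′ → flagAtom s′ ≡ just a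
  rule-setsFlag p (load _ q _ _ _)           = case trans (sym p) q of λ ()
  rule-setsFlag p (store q _ _ _)            = case trans (sym p) q of λ ()
  rule-setsFlag p (atomLoad _ _ _ _ _ refl)  = refl
  rule-setsFlag p (atomStore _ q _ _ _ _)    = case trans (sym p) q of λ ()
  rule-setsFlag p (nonMem q _ _)             = case trans (sym p) q of λ ()

  -- `load` and `nonMem` leave the flag alone, `store` and `atomLoad` need it undefined, and
  -- `atomStore` needs it to match the atom of `b`.
  rule-keepsFlag : ∀ {x s s′} → flagAtom s ≡ just a → Rule Sem x s b s′ →
                   flagAtom s′ ≡ just a ⊎ atomOf M b ≡ just a
  rule-keepsFlag f (load _ _ _ _ refl) =
    inj₁ (trans (exeLast-flag _ _ _) (trans (exePre-flag _ _) f))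
  rule-keepsFlag f (store _ g _ _)           = case trans (sym f) g of λ ()
  rule-keepsFlag f (atomLoad _ _ g _ _ _)    = case trans (sym f) g of λ ()
  rule-keepsFlag f (atomStore _ _ g at _ _)  = inj₂ (trans at (trans (sym g) f))
  rule-keepsFlag f (nonMem _ _ refl)         = inj₁ (trans (exe-flag _ _) f)

  rule-blocksStore : ∀ {x s s′} → flagAtom s ≡ just a → IsStore M b → Rule Sem x s b s′ →
                     atomOf M b ≡ just a
  rule-blocksStore f sb (load _ p _ _ _)         = contradiction refl (load≢store (inj₁ p) sb)
  rule-blocksStore f sb (store _ g _ _)          = case trans (sym f) g of λ ()
  rule-blocksStore f sb (atomLoad _ p _ _ _ _)   = contradiction refl (load≢store (inj₂ p) sb)
  rule-blocksStore f sb (atomStore _ _ g at _ _) = trans at (trans (sym g) f)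
  rule-blocksStore f sb (nonMem p _ _)           = contradiction refl (non≢store p sb)

  module _ {l s : Id} (l-ald : typeOf M l ≡ ald)
           (onlyStore : ∀ {id} → atomOf M id ≡ just l → id ≡ s) where

    -- The invariant behind Atomicity: executing `l` sets the flag, and only an atomic store with
    -- atom `l`, hence `s`, can clear it.
    run-flag : ∀ {x σ} → Run x σ → l ∈ x → flagAtom σ ≡ just l ⊎ s ∈ x
    run-flag (step {x = x} r rule) l∈ with ∈-++⁻ x l∈
    ... | inj₂ (here refl) = inj₁ (rule-setsFlag l-ald rule)
    ... | inj₁ l∈x with run-flag r l∈x
    ...   | inj₂ s∈x = inj₂ (∈-++⁺ˡ s∈x)
    ...   | inj₁ f   =
      -- If the identifier just appended has atom `l`, it is `s` itself, found at the end of the new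
      -- sequence.
      Sum.map₂ (λ at → ∈-++⁺ʳ x (here (sym (onlyStore at)))) (rule-keepsFlag f rule)

    run-atomic : ∀ {x σ} → Run x σ → l ∈ x → IsStore M a → a ∈ x → a ≢ s →
                 Before x a l ⊎ Before x s a
    run-atomic (step {x = x} r rule) l∈ sa a∈ a≢s with ∈-++⁻ x l∈ | ∈-++⁻ x a∈
    ... | inj₁ l∈x         | inj₁ a∈x         =
      Sum.map (before-++⁺ˡ {x}) (before-++⁺ˡ {x}) (run-atomic r l∈x sa a∈x a≢s)
    ... | inj₂ (here refl) | inj₁ a∈x         = inj₁ (before-∷ʳ a∈x)
    ... | inj₂ (here refl) | inj₂ (here refl) =
      contradiction refl (load≢store (inj₂ l-ald) sa)
    -- The decisive case: `a` is appended after `l`. A flag still equal to `l` would force `a` to be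
    -- `s`; otherwise `s` is already in the prefix.
    ... | inj₁ l∈x         | inj₂ (here refl) with run-flag r l∈x
    ...   | inj₁ f   = contradiction (onlyStore (rule-blocksStore f sa rule)) a≢s
    ...   | inj₂ s∈x = inj₂ (before-∷ʳ s∈x)

theorem1 : (I : ISA) (PO : ProgramOrder) (M : BlockMap I) (Sem : Semantics PO M)
    (n : ℕ) (E : Vector (Witness Sem) (suc n)) →
    ValidFinalExecution Sem E →
    let x = executed (last E) in
    (∀ id id′ → Order id id′ x M) ×
    (∀ id → Termination id PO x M) ×
    (∀ id id′ → LoadOp id id′ PO x M) ×
    (∀ id id′ → StoreStore id id′ PO x M) ×
    (∀ id id′ → Atomicity id id′ PO x M)
theorem1 I PO M Sem n E VF = order , (λ _ id∈PO _ → complete id∈PO) , loadOp , storeStore , atomicity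
  where
  open ValidFinalExecution VF
  open ValidExecution validExecution
  open ValidProgram validProgram

  x = executed (last E)

  run : Run Sem x (state (last E))
  run = validExecution⇒run Sem validExecution _

  complete : ∀ {id} → InProgram PO id → id ∈ x
  -- Finality identifies the executed identifiers with those initially remaining, which are those of
  -- the program.
  complete id∈PO = proj₁ final (proj₂ startRemaining id∈PO)

  order : ∀ id id′ → Order id id′ x M
  order _ _ _ _ id∈x id′∈x id≢id′ = Sum.map before⇒< before⇒< (before-connex id∈x id′∈x id≢id′)

  loadOp : ∀ id id′ → LoadOp id id′ PO x M
  loadOp _ _ l id︔id′ = before⇒<
    (run-before Sem (λ rule → rule-load Sem rule l id︔id′) run (complete (︔⇒InProgramʳ id︔id′)))

  storeStore : ∀ id id′ → StoreStore id id′ PO x M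
  storeStore _ _ s s′ id︔id′ = before⇒<
    (run-before Sem (λ rule → rule-store Sem rule s s′ id︔id′) run (complete (︔⇒InProgramʳ id︔id′)))

  atomicity : ∀ id id′ → Atomicity id id′ PO x M
  atomicity l s at l︔s l-ald s-ast =
    loadOp l s (inj₂ l-ald) l︔s ,
    λ _ sa a∈x a≢s → Sum.map before⇒< before⇒<
      (run-atomic Sem l-ald onlyStore run (complete (︔⇒InProgramˡ l︔s)) sa a∈x a≢s)
    where
    onlyStore : ∀ {id} → atomOf M id ≡ just l → id ≡ s
    -- `atomInjective` only refutes a second block with atom `l`; decidable equality of identifiers
    -- turns this into an equation.
    onlyStore {id} at′ = decidable-stable (id ≟ s) λ id≢s →
      atomInjective s l id at (λ s≡id → id≢s (sym s≡id)) at′
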